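{- For every integer $k>4$ there exists a finite simple graph $G$ such that, defining $G_0=G$ and $G_{t+1}=P^k(G_t)$ for $t\ge 0$, we have $G_{t+1}\neq G_t$ for every $t\ge 0$. In other words, iterating $k$-intersection polishing starting from $G$ never reaches a $k$-intersection polished graph.
   Context: All graphs are finite and simple. For a vertex $v$, $N[v]$ denotes its closed neighbourhood (the set of neighbours of $v$ together with $v$). For an integer $k$, $P^k(G)$ is the graph on the same vertex set as $G$ in which two distinct vertices $u,v$ are adjacent if and only if $|N[u]\cap N[v]|\ge k$, the closed neighbourhoods being taken in $G$. A graph $G$ is called $k$-intersection polished if $P^k(G)=G$ (equality of edge sets on the same vertex set). -}

module Defs where

open import Data.Fin.Base using (Fin)
open import Data.Fin.Properties using (_≟_)
open import Data.Fin.Subset using (Subset; _∩_; ∣_∣)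
open import Data.Fin.Subset.Properties using (∩-comm)
open import Data.Nat.Base using (ℕ; zero; suc; _≤_)
open import Data.Nat.Properties using (_≤?_)
open import Data.Product.Base using (_×_; _,_)
open import Data.Vec.Base using (tabulate)
open import Function.Base using (_∘_)
open import Function.Bundles using (_⇔_)
open import Level using (0ℓ)
open import Relation.Binary.Core using (Rel)
open import Relation.Binary.Definitions using (Decidable; Irreflexive; Symmetric)
open import Relation.Binary.PropositionalEquality using (_≡_; _≢_; sym; subst; cong)
open import Relation.Nullary.Decidable using (does; ¬?; _×-dec_; _⊎-dec_)

record Graph (n : ℕ) : Set₁ where
  field
    Adj        : Rel (Fin n) 0ℓ
    adj?       : Decidable Adj
    adj-sym    : Symmetric Adj
    adj-irrefl : Irreflexive _≡_ Adj

open Graph public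

infix 4 _≈_

-- Equality of edge sets on the same vertex set; _≡_ on the records would
-- also compare the proof components.
_≈_ : {n : ℕ} → Graph n → Graph n → Set
G ≈ H = ∀ u v → Adj G u v ⇔ Adj H u v

-- Closed neighbourhood.
N[_] : {n : ℕ} → Graph n → Fin n → Subset n
N[ G ] v = tabulate (λ w → does (w ≟ v ⊎-dec adj? G v w))

P : {n : ℕ} → ℕ → Graph n → Graph n
P k G = record
  { Adj        = λ u v → u ≢ v × k ≤ ∣ N[ G ] u ∩ N[ G ] v ∣
  ; adj?       = λ u v → ¬? (u ≟ v) ×-dec (k ≤? ∣ N[ G ] u ∩ N[ G ] v ∣)
  ; adj-sym    = λ {u} {v} (u≢v , k≤) →
                   u≢v ∘ sym , subst (k ≤_) (cong ∣_∣ (∩-comm (N[ G ] u) (N[ G ] v))) k≤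
  ; adj-irrefl = λ u≡v (u≢v , _) → u≢v u≡v
  }

polishing : {n : ℕ} → ℕ → Graph n → ℕ → Graph n
polishing k G zero    = G
polishing k G (suc t) = P k (polishing k G t)

{-# OPTIONS --safe #-}
module Submission where

-- For k = 5 the circulant graph on ℤ/18 with connection set S = {±1, ±2, ±5, ±6}
-- is polished to the one with connection set 7S, so the iteration goes round
-- S → 7S → 49S → S. Coning with a new apex raises every intersection of closed
-- neighbourhoods by one, hence carries the cycle from k to k + 1; the apex stays
-- universal because all closed neighbourhoods have at least k elements.

open import Data.Bool.Base using (true)
open import Data.Empty using (⊥)
open import Data.Fin.Base using (Fin; zero; suc; toℕ)
open import Data.Fin.Properties using (all?) renaming (_≟_ to _≟ᶠ_)
open import Data.Fin.Subset using (⊤; _∩_; ∣_∣)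
open import Data.Fin.Subset.Properties using (∩-comm; ∩-identityˡ; ∣p∩q∣≤∣p∣)
open import Data.List.Base using (List; []; _∷_)
open import Data.List.Membership.DecPropositional using () renaming (_∈?_ to ∈?; _∉?_ to ∉?)
open import Data.List.Membership.Propositional using (_∈_; _∉_)
open import Data.Nat.Base using (ℕ; zero; suc; _≤_; _>_; s≤s; s≤s⁻¹; _≤′_; ≤′-refl; ≤′-step; ∣_-_∣)
open import Data.Nat.Properties using (_≟_; _≤?_; ≤⇒≤′; ∣-∣-comm; ∣n-n∣≡0; module ≤-Reasoning)
open import Data.Product.Base using (∃-syntax; Σ-syntax; _,_)
open import Data.Sum.Function.Propositional using (_⊎-⇔_)
open import Data.Unit.Base using (tt) renaming (⊤ to Unit)
open import Data.Vec.Base using (tabulate)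
open import Data.Vec.Properties using (tabulate-cong; tabulate-allFin; map-const)
open import Defs
open import Function.Base using (_∘_)
open import Function.Bundles using (_⇔_; mk⇔; Equivalence)
open import Function.Properties.Equivalence using () renaming (refl to ⇔-refl; sym to ⇔-sym; trans to ⇔-trans)
open import Level using (0ℓ)
open import Relation.Binary.Core using (Rel)
open import Relation.Binary.PropositionalEquality using (_≡_; refl; sym; trans; cong; cong₂; subst)
open import Relation.Nullary.Decidable
  using (Dec; yes; no; True; toWitness; map′; _×-dec_; _→-dec_; _⊎-dec_; does-⇔; from-yes; from-no)
open import Relation.Nullary.Negation.Core using (¬_; contradiction)

private variable
  k n : ℕ

-- There are only finitely many pairs of vertices to compare; this lets the 18-vertex case be
-- settled by evaluation.
_≈?_ : (G H : Graph n) → Dec (G ≈ H)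
G ≈? H = all? λ u → all? λ v →
  map′ (λ (to , from) → mk⇔ to from) (λ e → Equivalence.to e , Equivalence.from e)
    ((adj? G u v →-dec adj? H u v) ×-dec (adj? H u v →-dec adj? G u v))

-- Although `adj?` may differ between the two graphs, the truth value of a decision depends only on
-- whether its proposition holds.
N-cong : (G H : Graph n) → G ≈ H → ∀ v → N[ G ] v ≡ N[ H ] v
N-cong G H G≈H v = tabulate-cong λ w →
  does-⇔ (⇔-refl ⊎-⇔ G≈H v w) (w ≟ᶠ v ⊎-dec adj? G v w) (w ≟ᶠ v ⊎-dec adj? H v w)

P-cong : (G H : Graph n) → G ≈ H → P k G ≈ P k H
P-cong {k = k} G H G≈H u v = mk⇔
  (λ (u≢v , k≤) → u≢v , subst (k ≤_) ∣≡∣ k≤)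
  (λ (u≢v , k≤) → u≢v , subst (k ≤_) (sym ∣≡∣) k≤)
  where
  ∣≡∣ : ∣ N[ G ] u ∩ N[ G ] v ∣ ≡ ∣ N[ H ] u ∩ N[ H ] v ∣
  ∣≡∣ = cong₂ (λ X Y → ∣ X ∩ Y ∣) (N-cong G H G≈H u) (N-cong G H G≈H v)

ConeAdj : Graph n → Rel (Fin (suc n)) 0ℓ
ConeAdj G zero    zero    = ⊥
ConeAdj G zero    (suc v) = Unit
ConeAdj G (suc u) zero    = Unit
ConeAdj G (suc u) (suc v) = Adj G u v

cone : Graph n → Graph (suc n)
cone G = record
  { Adj        = ConeAdj G
  ; adj?       = λ { zero zero → no λ () ; zero (suc v) → yes tt
                   ; (suc u) zero → yes tt ; (suc u) (suc v) → adj? G u v }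
  ; adj-sym    = λ { {zero} {suc v} _ → tt ; {suc u} {zero} _ → tt
                   ; {suc u} {suc v} uv → adj-sym G uv }
  ; adj-irrefl = λ { {suc u} refl uu → adj-irrefl G refl uu }
  }

cone-cong : (G H : Graph n) → G ≈ H → cone G ≈ cone H
cone-cong G H G≈H zero    zero    = ⇔-refl
cone-cong G H G≈H zero    (suc v) = ⇔-refl
cone-cong G H G≈H (suc u) zero    = ⇔-refl
cone-cong G H G≈H (suc u) (suc v) = G≈H u v

tabulate-true : tabulate {n = n} (λ _ → true) ≡ ⊤
tabulate-true = trans (tabulate-allFin _) (map-const _ true)

apex-∩ : (G : Graph n) (v : Fin n) →
         ∣ N[ cone G ] zero ∩ N[ cone G ] (suc v) ∣ ≡ suc ∣ N[ G ] v ∣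
-- The apex is the first entry of both vectors and supplies the `suc`; on the old vertices its
-- neighbourhood is `⊤`.
apex-∩ G v = cong (λ X → suc ∣ X ∣)
  (trans (cong (_∩ N[ G ] v) tabulate-true) (∩-identityˡ (N[ G ] v)))

P-cone : (G : Graph n) → (∀ v → k ≤ ∣ N[ G ] v ∣) → P (suc k) (cone G) ≈ cone (P k G)
P-cone G large zero zero = mk⇔ (λ (0≢0 , _) → 0≢0 refl) λ ()
P-cone {k = k} G large zero (suc v) = mk⇔ (λ _ → tt) λ _ →
  (λ ()) , subst (suc k ≤_) (sym (apex-∩ G v)) (s≤s (large v))
P-cone {k = k} G large (suc u) zero = mk⇔ (λ _ → tt) λ _ →
  (λ ()) , subst (suc k ≤_)
    (sym (trans (cong ∣_∣ (∩-comm (N[ cone G ] (suc u)) (N[ cone G ] zero))) (apex-∩ G u)))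
    (s≤s (large u))
-- Both neighbourhoods contain the apex as first entry, so the size of the intersection computes to
-- the successor of the old one.
P-cone G large (suc u) (suc v) = mk⇔
  (λ (u≢v , k≤) → u≢v ∘ cong suc , s≤s⁻¹ k≤)
  (λ (u≢v , k≤) → (λ { refl → u≢v refl }) , s≤s k≤)

-- The graphs are prescribed instead of being literal iterates of `P`, so a periodic sequence needs
-- only finitely many checks. The field `large` keeps the apex universal under coning.
record Orbit (k n : ℕ) : Set₁ where
  field
    at    : ℕ → Graph n
    step  : ∀ t → P k (at t) ≈ at (suc t)
    moves : ∀ t → ¬ (at (suc t) ≈ at t)
    large : ∀ t v → k ≤ ∣ N[ at t ] v ∣

open Orbit

polishing≈at : (O : Orbit k n) → ∀ t → polishing k (at O 0) t ≈ at O t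
polishing≈at O zero    u v = ⇔-refl
polishing≈at {k = k} O (suc t) u v = ⇔-trans
  (P-cong (polishing k (at O 0) t) (at O t) (polishing≈at O t) u v)
  (step O t u v)

coneOrbit : Orbit k n → Orbit (suc k) (suc n)
-- On the empty vertex set all graphs agree, contradicting `moves`; below, an old vertex is thus
-- available.
coneOrbit {n = zero} O = contradiction (λ ()) (moves O 0)
coneOrbit {k = k} {n = suc _} O = record
  { at    = λ t → cone (at O t)
  ; step  = λ t u v → ⇔-trans
              (P-cone (at O t) (large O t) u v)
              (cone-cong (P k (at O t)) (at O (suc t)) (step O t) u v)
  ; moves = λ t eq → moves O t λ u v → eq (suc u) (suc v)
  ; large = λ { t zero → large-apex t ; t (suc v) → s≤s (large O t v) }
  }
  where
  large-apex : ∀ t → suc k ≤ ∣ N[ cone (at O t) ] zero ∣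
  -- The apex neighbourhood is bounded below by its intersection with that of an old vertex, whose
  -- size is known.
  large-apex t = begin
    suc k                                                          ≤⟨ s≤s (large O t zero) ⟩
    suc ∣ N[ at O t ] zero ∣                                       ≡⟨ apex-∩ (at O t) zero ⟨
    ∣ N[ cone (at O t) ] zero ∩ N[ cone (at O t) ] (suc zero) ∣    ≤⟨ ∣p∩q∣≤∣p∣ (N[ cone (at O t) ] zero) (N[ cone (at O t) ] (suc zero)) ⟩
    ∣ N[ cone (at O t) ] zero ∣                                    ∎
    where open ≤-Reasoning

distanceGraph : (n : ℕ) (D : List ℕ) → 0 ∉ D → Graph n
distanceGraph n D 0∉D = record
  { Adj        = λ u v → ∣ toℕ u - toℕ v ∣ ∈ D
  ; adj?       = λ u v → ∈? _≟_ ∣ toℕ u - toℕ v ∣ D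
  ; adj-sym    = λ {u} {v} → subst (_∈ D) (∣-∣-comm (toℕ u) (toℕ v))
  ; adj-irrefl = λ { {u} refl → 0∉D ∘ subst (_∈ D) (∣n-n∣≡0 (toℕ u)) }
  }

circulant : (D : List ℕ) {_ : True (∉? _≟_ 0 D)} → Graph 18
circulant D {0∉D} = distanceGraph 18 D (toWitness 0∉D)

-- Vertices are compared by their absolute difference as naturals, so a residue
-- ±d of ℤ/18 is listed both as d and as 18 − d.
S₀ S₁ S₂ : Graph 18
S₀ = circulant (1 ∷ 2 ∷ 5 ∷ 6 ∷ 12 ∷ 13 ∷ 16 ∷ 17 ∷ [])
S₁ = circulant (1 ∷ 4 ∷ 6 ∷ 7 ∷ 11 ∷ 12 ∷ 14 ∷ 17 ∷ [])
S₂ = circulant (5 ∷ 6 ∷ 7 ∷ 8 ∷ 10 ∷ 11 ∷ 12 ∷ 13 ∷ [])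

large? : (k : ℕ) (G : Graph n) → Dec (∀ v → k ≤ ∣ N[ G ] v ∣)
large? k G = all? λ v → k ≤? ∣ N[ G ] v ∣

orbit₅ : Orbit 5 18
orbit₅ = record { at = S ; step = S-step ; moves = S-moves ; large = S-large }
  where
  S : ℕ → Graph 18
  S 0 = S₀
  S 1 = S₁
  S 2 = S₂
  -- The period is three because 7³ = 343 = 19 · 18 + 1.
  S (suc (suc (suc t))) = S t

  S-step : ∀ t → P 5 (S t) ≈ S (suc t)
  S-step 0 = from-yes (P 5 S₀ ≈? S₁)
  S-step 1 = from-yes (P 5 S₁ ≈? S₂)
  S-step 2 = from-yes (P 5 S₂ ≈? S₀)
  S-step (suc (suc (suc t))) = S-step t

  S-moves : ∀ t → ¬ (S (suc t) ≈ S t)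
  S-moves 0 = from-no (S₁ ≈? S₀)
  S-moves 1 = from-no (S₂ ≈? S₁)
  S-moves 2 = from-no (S₀ ≈? S₂)
  S-moves (suc (suc (suc t))) = S-moves t

  S-large : ∀ t v → 5 ≤ ∣ N[ S t ] v ∣
  S-large 0 = from-yes (large? 5 S₀)
  S-large 1 = from-yes (large? 5 S₁)
  S-large 2 = from-yes (large? 5 S₂)
  S-large (suc (suc (suc t))) = S-large t

-- Each `≤′-step` adds one apex, so the orbit lives on k + 13 vertices.
orbit : 5 ≤′ k → ∃[ n ] Orbit k n
orbit ≤′-refl       = 18 , orbit₅
orbit (≤′-step 5≤k) = let n , O = orbit 5≤k in suc n , coneOrbit O

theorem2 : (k : ℕ) → k > 4 → ∃[ n ] Σ[ G ∈ Graph n ] (∀ (t : ℕ) → ¬ (polishing k G (suc t) ≈ polishing k G t))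
theorem2 k k>4 = let n , O = orbit (≤⇒≤′ k>4) in
  -- A fixed point among the iterates would transfer along `polishing≈at` to two consecutive graphs
  -- of the orbit.
  n , at O 0 , λ t eq → moves O t λ u v →
    ⇔-trans (⇔-sym (polishing≈at O (suc t) u v)) (⇔-trans (eq u v) (polishing≈at O t u v))
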